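{- Let $F$ be a one-dimensional tropical fan in $\mathbb{R}^n$ whose rays span $\mathbb{R}^n$, let $u_1,u_2,u_3$ be primitive generators of rays of $F$, and let $l,h\in(\mathbb{Z}^n)^\vee$. If $g_l(u_1,u_2)\in\mathrm{Gly}(F)$, $g_h(u_1,u_3)\in\mathrm{Gly}(F)$ and $u_2\ne u_3$, then $g_f(u_2,u_3)\in\mathrm{Gly}(F)$ for some $f\in(\mathbb{Z}^n)^\vee$.
   Context: A one-dimensional tropical fan $F$ in $\mathbb{R}^n$ consists of finitely many distinct rays $\mathbb{R}_+v_1,\dots,\mathbb{R}_+v_q$ (and the origin), with $v_i\in\mathbb{Z}^n$ primitive, together with positive integer weights $\omega_1,\dots,\omega_q$ satisfying the balancing condition $\sum_i\omega_iv_i=0$. For $l\in(\mathbb{Z}^n)^\vee$ put $\max(0,l)\cdot F=\sum_i\omega_i\max(0,l(v_i))$. If this equals $1$, the gallery of $F$ over $\max(0,l)$ is the set of rays $\mathbb{R}_+v_i$ of $F$ with $|l(v_i)|=1$. $\mathrm{Gly}(F)$ is the set of all galleries of $F$. The notation $g_l(v_a,v_b)\in\mathrm{Gly}(F)$ means that $\max(0,l)\cdot F=1$, that the gallery over $\max(0,l)$ is $\{\mathbb{R}_+v_a,\mathbb{R}_+v_b\}$, and that $l(v_a)=1$, $l(v_b)=-1$; equivalently, $l(v_a)=1$, $l(v_b)=-1$, $\omega_a=\omega_b=1$ and $l(v_i)=0$ for all $i\ne a,b$. -}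

module Defs where

open import Algebra.Bundles using (AbelianGroup)
import Algebra.Construct.Pointwise as Pointwise
open import Algebra.Morphism.Bundles using (GroupHomomorphism)
import Algebra.Properties.CommutativeMonoid.Sum as Sum
open import Data.Fin.Base using (Fin)
open import Data.Integer.Base as ℤ using (ℤ; +_; 0ℤ; 1ℤ; -1ℤ; _⊔_)
open import Data.Integer.Divisibility using (_∣_)
import Data.Integer.Properties as ℤ
open import Data.Nat.Base as ℕ using (ℕ)
import Data.Nat.Properties as ℕ
open import Data.Product.Base using (∃; _×_; _,_)
open import Data.Rational.Base as ℚ using (ℚ; 0ℚ; 1ℚ; ½)
import Data.Rational.Properties as ℚ
open import Data.Rational.Solver using (module +-*-Solver)
open import Data.Sum.Base using (_⊎_)
open import Data.Vec.Functional using (Vector; foldr)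
open import Level using (0ℓ) renaming (suc to lsuc)
open import Relation.Binary.PropositionalEquality
  using (_≡_; _≢_; refl; cong; subst)
open import Relation.Nullary.Negation using (¬_)
open import Relation.Unary using (Pred; _∈_; _≐_)

-- The real numbers: Cauchy sequences of rationals, with sequences whose
-- difference tends to 0 identified by _≃_.
--
-- Since all rays have integral generators, the only operations needed to
-- speak of rays and linear spans are addition of reals and multiplication
-- of a real by an integer.

record ℝ : Set where
  field
    seq    : ℕ → ℚ
    cauchy : ∀ ε → 0ℚ ℚ.< ε →
             ∃ λ N → ∀ m k → N ℕ.≤ m → N ℕ.≤ k →
             ℚ.∣ seq m ℚ.- seq k ∣ ℚ.< ε

open ℝ public

infix 4 _≃_

_≃_ : ℝ → ℝ → Set
x ≃ y = ∀ ε → 0ℚ ℚ.< ε →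
        ∃ λ N → ∀ m → N ℕ.≤ m → ℚ.∣ seq x m ℚ.- seq y m ∣ ℚ.< ε

NonNegative : ℝ → Set
NonNegative x = ∀ ε → 0ℚ ℚ.< ε →
                ∃ λ N → ∀ m → N ℕ.≤ m → ℚ.- ε ℚ.< seq x m

0ℝ : ℝ
0ℝ = record { seq = λ _ → 0ℚ ; cauchy = λ ε 0<ε → 0 , λ _ _ _ _ → 0<ε }

infixl 6 _+ℝ_
infixl 7 _·_

_+ℝ_ : ℝ → ℝ → ℝ
x +ℝ y = record { seq = λ m → seq x m ℚ.+ seq y m ; cauchy = c }
  where
  open +-*-Solver
  open ℚ.≤-Reasoning

  c : ∀ ε → 0ℚ ℚ.< ε → ∃ λ N → ∀ m k → N ℕ.≤ m → N ℕ.≤ k →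
      ℚ.∣ (seq x m ℚ.+ seq y m) ℚ.- (seq x k ℚ.+ seq y k) ∣ ℚ.< ε
  c ε 0<ε with cauchy x (½ ℚ.* ε) (ℚ.*-monoʳ-<-pos ½ 0<ε)
             | cauchy y (½ ℚ.* ε) (ℚ.*-monoʳ-<-pos ½ 0<ε)
  ... | M , f | N , g = M ℕ.⊔ N , λ m k m≥ k≥ → begin-strict
    ℚ.∣ (seq x m ℚ.+ seq y m) ℚ.- (seq x k ℚ.+ seq y k) ∣
      ≡⟨ cong ℚ.∣_∣ (solve 4 (λ a b c d →
           (a :+ b) :- (c :+ d) := (a :- c) :+ (b :- d))
           refl (seq x m) (seq y m) (seq x k) (seq y k)) ⟩
    ℚ.∣ (seq x m ℚ.- seq x k) ℚ.+ (seq y m ℚ.- seq y k) ∣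
      ≤⟨ ℚ.∣p+q∣≤∣p∣+∣q∣ (seq x m ℚ.- seq x k) (seq y m ℚ.- seq y k) ⟩
    ℚ.∣ seq x m ℚ.- seq x k ∣ ℚ.+ ℚ.∣ seq y m ℚ.- seq y k ∣
      <⟨ ℚ.+-mono-< (f m k (ℕ.m⊔n≤o⇒m≤o M N m≥) (ℕ.m⊔n≤o⇒m≤o M N k≥))
                    (g m k (ℕ.m⊔n≤o⇒n≤o M N m≥) (ℕ.m⊔n≤o⇒n≤o M N k≥)) ⟩
    ½ ℚ.* ε ℚ.+ ½ ℚ.* ε
      ≡⟨ solve 1 (λ e → con ½ :* e :+ con ½ :* e := e) refl ε ⟩
    ε ∎

_·_ : ℝ → ℤ → ℝ
x · z = record { seq = λ m → seq x m ℚ.* r ; cauchy = c }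
  where
  open +-*-Solver
  open ℚ.≤-Reasoning

  r b : ℚ
  r = z ℚ./ 1
  b = 1ℚ ℚ.+ ℚ.∣ r ∣

  instance
    b-pos : ℚ.Positive b
    b-pos = ℚ.pos+nonNeg⇒pos 1ℚ ℚ.∣ r ∣ {{ℚ.∣-∣-nonNeg r}}

    b-nonZero : ℚ.NonZero b
    b-nonZero = ℚ.pos⇒nonZero b

    1/b-pos : ℚ.Positive (ℚ.1/ b)
    1/b-pos = ℚ.1/pos⇒pos b

  ∣r∣≤b : ℚ.∣ r ∣ ℚ.≤ b
  ∣r∣≤b = subst (ℚ._≤ b) (ℚ.+-identityˡ ℚ.∣ r ∣)
            (ℚ.+-monoˡ-≤ ℚ.∣ r ∣ (ℚ.nonNegative⁻¹ 1ℚ))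

  c : ∀ ε → 0ℚ ℚ.< ε → ∃ λ N → ∀ m k → N ℕ.≤ m → N ℕ.≤ k →
      ℚ.∣ seq x m ℚ.* r ℚ.- seq x k ℚ.* r ∣ ℚ.< ε
  c ε 0<ε with cauchy x (ε ℚ.* ℚ.1/ b)
                 (subst (ℚ._< ε ℚ.* ℚ.1/ b) (ℚ.*-zeroˡ (ℚ.1/ b))
                   (ℚ.*-monoˡ-<-pos (ℚ.1/ b) 0<ε))
  ... | N , f = N , λ m k m≥ k≥ →
    let d = seq x m ℚ.- seq x k in begin-strict
    ℚ.∣ seq x m ℚ.* r ℚ.- seq x k ℚ.* r ∣
      ≡⟨ cong ℚ.∣_∣ (solve 3 (λ p q s → p :* s :- q :* s := (p :- q) :* s)
           refl (seq x m) (seq x k) r) ⟩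
    ℚ.∣ d ℚ.* r ∣
      ≡⟨ ℚ.∣p*q∣≡∣p∣*∣q∣ d r ⟩
    ℚ.∣ d ∣ ℚ.* ℚ.∣ r ∣
      ≤⟨ ℚ.*-monoˡ-≤-nonNeg ℚ.∣ d ∣ {{ℚ.∣-∣-nonNeg d}} ∣r∣≤b ⟩
    ℚ.∣ d ∣ ℚ.* b
      <⟨ ℚ.*-monoˡ-<-pos b (f m k m≥ k≥) ⟩
    ε ℚ.* ℚ.1/ b ℚ.* b
      ≡⟨ ℚ.*-assoc ε (ℚ.1/ b) b ⟩
    ε ℚ.* (ℚ.1/ b ℚ.* b)
      ≡⟨ cong (ε ℚ.*_) (ℚ.*-inverseˡ b) ⟩
    ε ℚ.* 1ℚ
      ≡⟨ ℚ.*-identityʳ ε ⟩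
    ε ∎

-- The carrier is Vector ℤ n, with pointwise equality.
ℤ^ : ℕ → AbelianGroup 0ℓ 0ℓ
ℤ^ n = Pointwise.abelianGroup (Fin n) ℤ.+-0-abelianGroup

infix 4 _≈_

_≈_ : ∀ {n} → Vector ℤ n → Vector ℤ n → Set
_≈_ {n} = AbelianGroup._≈_ (ℤ^ n)

Dual : ℕ → Set
Dual n = GroupHomomorphism (AbelianGroup.rawGroup (ℤ^ n))
                           (AbelianGroup.rawGroup ℤ.+-0-abelianGroup)

infix 8 _⟨_⟩

_⟨_⟩ : ∀ {n} → Dual n → Vector ℤ n → ℤ
l ⟨ v ⟩ = GroupHomomorphism.⟦_⟧ l v

-- The zero vector is excluded, as every integer divides its coordinates.
Primitive : ∀ {n} → Vector ℤ n → Set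
Primitive v = ∀ d → (∀ j → d ∣ v j) → ℤ.∣ d ∣ ≡ 1

sumℤ : ∀ {q} → Vector ℤ q → ℤ
sumℤ = Sum.sum ℤ.+-0-commutativeMonoid

-- The subset ℝ₊v of ℝⁿ.
ray : ∀ {n} → Vector ℤ n → Pred (Vector ℝ n) 0ℓ
ray v x = ∃ λ t → NonNegative t × (∀ j → x j ≃ t · v j)

record TropicalFan₁ (n : ℕ) : Set where
  field
    q           : ℕ
    v           : Fin q → Vector ℤ n
    ω           : Fin q → ℕ
    v-primitive : ∀ i → Primitive (v i)
    distinct    : ∀ {i k} → i ≢ k → ¬ (ray (v i) ≐ ray (v k))
    ω-positive  : ∀ i → 0 ℕ.< ω i
    balanced    : ∀ j → sumℤ (λ i → + ω i ℤ.* v i j) ≡ 0ℤ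

SetOfRays : ℕ → Set₁
SetOfRays n = Pred (Pred (Vector ℝ n) 0ℓ) 0ℓ

module _ {n : ℕ} (F : TropicalFan₁ n) where
  open TropicalFan₁ F

  PrimitiveGenerator : Pred (Vector ℤ n) 0ℓ
  PrimitiveGenerator u = ∃ λ i → u ≈ v i

  RaysSpan : Set
  RaysSpan = ∀ (x : Vector ℝ n) → ∃ λ (c : Vector ℝ q) →
             ∀ j → x j ≃ foldr _+ℝ_ 0ℝ (λ i → c i · v i j)

  max[0,_]·F : Dual n → ℤ
  max[0, l ]·F = sumℤ (λ i → + ω i ℤ.* (0ℤ ⊔ l ⟨ v i ⟩))

  -- G is the gallery of F over max(0,l), which is defined only when
  -- max(0,l)·F = 1.
  record IsGalleryOver (l : Dual n) (G : SetOfRays n) : Set₁ where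
    field
      degree  : max[0, l ]·F ≡ 1ℤ
      gallery : G ≐ λ R → ∃ λ i → R ≐ ray (v i) × ℤ.∣ l ⟨ v i ⟩ ∣ ≡ 1

  Gly : Pred (SetOfRays n) (lsuc 0ℓ)
  Gly G = ∃ λ l → IsGalleryOver l G

  -- The relation written g_l(a,b) ∈ Gly(F).
  record g∈Gly (l : Dual n) (a b : Vector ℤ n) : Set₁ where
    field
      isGallery : IsGalleryOver l λ R → R ≐ ray a ⊎ R ≐ ray b
      l⟨a⟩≡1    : l ⟨ a ⟩ ≡ 1ℤ
      l⟨b⟩≡-1   : l ⟨ b ⟩ ≡ -1ℤ

    ∈Gly : (λ R → R ≐ ray a ⊎ R ≐ ray b) ∈ Gly
    ∈Gly = l , isGallery

{-# OPTIONS --safe #-}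
-- Balancing gives max(0,−l)·F = max(0,l)·F = 1, and a sum of nonnegative
-- integers equal to 1 has only one nonzero term.  Hence l vanishes on every ray
-- other than u₁, u₂, likewise h on every ray other than u₁, u₃, and f = h − l
-- works: its positive part agrees with that of −l on all rays.
module Submission where

open import Defs
open import Algebra.Morphism.Bundles using (GroupHomomorphism)
import Algebra.Properties.CommutativeMonoid.Sum as Sum
open import Data.Empty using (⊥-elim)
open import Data.Fin.Base using (Fin; zero; suc)
open import Data.Fin.Properties using (_≟_)
open import Data.Integer.Base as ℤ
  using (ℤ; +_; +[1+_]; -[1+_]; 0ℤ; 1ℤ; -1ℤ; _+_; _-_; _*_; -_; _⊔_; _≤_; +≤+)
open import Data.Integer.Properties hiding (_≟_)
open import Data.Integer.Tactic.RingSolver using (solve-∀)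
open import Data.Nat.Base as ℕ using (ℕ)
import Data.Nat.Properties as ℕ
open import Data.Product.Base using (∃; _×_; _,_)
open import Data.Sum.Base using (_⊎_; inj₁; inj₂; [_,_]′)
open import Data.Vec.Functional using (Vector)
open import Function.Base using (_∘_)
open import Relation.Binary.PropositionalEquality
open import Relation.Nullary.Decidable using (yes; no)
open import Relation.Nullary.Negation using (¬_)
open import Relation.Unary using (_∈_; _⊆_; _≐_)
open import Relation.Unary.Properties using (≐-trans)

open Sum +-0-commutativeMonoid using (sum-cong-≗; ∑-distrib-+)

sum-nonNeg : ∀ {q} {t : Vector ℤ q} → (∀ i → 0ℤ ≤ t i) → 0ℤ ≤ sumℤ t
sum-nonNeg {ℕ.zero}  t≥0 = ≤-refl
sum-nonNeg {ℕ.suc q} t≥0 = +-mono-≤ (t≥0 zero) (sum-nonNeg (t≥0 ∘ suc))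

term≤sum : ∀ {q} {t : Vector ℤ q} → (∀ i → 0ℤ ≤ t i) → ∀ i → t i ≤ sumℤ t
term≤sum {t = t} t≥0 zero =
  subst (_≤ sumℤ t) (+-identityʳ (t zero)) (+-monoʳ-≤ (t zero) (sum-nonNeg (t≥0 ∘ suc)))
term≤sum {t = t} t≥0 (suc i) =
  subst (_≤ sumℤ t) (+-identityˡ (t (suc i))) (+-mono-≤ (t≥0 zero) (term≤sum (t≥0 ∘ suc) i))

terms≤sum : ∀ {q} {t : Vector ℤ q} → (∀ i → 0ℤ ≤ t i) →
            ∀ {i k} → i ≢ k → t i + t k ≤ sumℤ t
terms≤sum t≥0 {zero}  {zero}  i≢k = ⊥-elim (i≢k refl)
terms≤sum {t = t} t≥0 {zero}  {suc k} i≢k = +-monoʳ-≤ (t zero) (term≤sum (t≥0 ∘ suc) k)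
terms≤sum {t = t} t≥0 {suc i} {zero}  i≢k =
  subst (_≤ sumℤ t) (+-comm (t zero) (t (suc i))) (+-monoʳ-≤ (t zero) (term≤sum (t≥0 ∘ suc) i))
terms≤sum {t = t} t≥0 {suc i} {suc k} i≢k =
  subst (_≤ sumℤ t) (+-identityˡ (t (suc i) + t (suc k)))
    (+-mono-≤ (t≥0 zero) (terms≤sum (t≥0 ∘ suc) (i≢k ∘ cong suc)))

1≤m*1 : ∀ {m} → 0 ℕ.< m → 1ℤ ≤ + m * (0ℤ ⊔ 1ℤ)
1≤m*1 {m} 0<m = subst (1ℤ ≤_) (sym (*-identityʳ (+ m))) (+≤+ 0<m)

support-positivePart :
  ∀ {q} (ω : Fin q → ℕ) → (∀ i → 0 ℕ.< ω i) → (φ : Vector ℤ q) →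
  sumℤ (λ i → + ω i * (0ℤ ⊔ φ i)) ≡ 1ℤ →
  ∀ {a i} → φ a ≡ 1ℤ → a ≢ i → φ i ≤ 0ℤ
support-positivePart ω ω>0 φ ∑≡1 {a} {i} φa≡1 a≢i = begin
  φ i         ≤⟨ i≤j⊔i 0ℤ (φ i) ⟩
  0ℤ ⊔ φ i    ≤⟨ *-cancelˡ-≤-pos (0ℤ ⊔ φ i) 0ℤ (+ ω i) {{ℤ.positive (ℤ.+<+ (ω>0 i))}}
                   (subst (t i ≤_) (sym (*-zeroʳ (+ ω i))) ti≤0) ⟩
  0ℤ          ∎
  where
  open ≤-Reasoning

  t : Vector ℤ _
  t i = + ω i * (0ℤ ⊔ φ i)

  t≥0 : ∀ i → 0ℤ ≤ t i
  t≥0 i = subst (_≤ t i) (*-zeroʳ (+ ω i)) (*-monoˡ-≤-nonNeg (+ ω i) (i≤i⊔j 0ℤ (φ i)))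

  ti≤0 : t i ≤ 0ℤ
  ti≤0 = subst (_≤ 0ℤ) (i+j-i≡j 1ℤ (t i)) (i≤j⇒i-j≤0 (begin
    1ℤ + t i    ≤⟨ +-monoˡ-≤ (t i) (subst (λ z → 1ℤ ≤ + ω a * (0ℤ ⊔ z)) (sym φa≡1) (1≤m*1 (ω>0 a))) ⟩
    t a + t i   ≤⟨ terms≤sum t≥0 a≢i ⟩
    sumℤ t      ≡⟨ ∑≡1 ⟩
    1ℤ          ∎))
    where
    i+j-i≡j : ∀ i j → i + j - i ≡ j
    i+j-i≡j = solve-∀

positivePart-neg : ∀ z → 0ℤ ⊔ z ≡ z + (0ℤ ⊔ - z)
positivePart-neg (+ 0)      = refl
positivePart-neg +[1+ k ]   = sym (+-identityʳ +[1+ k ])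
positivePart-neg -[1+ k ]   = sym (+-inverseˡ +[1+ k ])

module _ {n : ℕ} where

  ⟨⟩-cong : (l : Dual n) {u w : Vector ℤ n} → u ≈ w → l ⟨ u ⟩ ≡ l ⟨ w ⟩
  ⟨⟩-cong l = GroupHomomorphism.⟦⟧-cong l

  ⟨⟩-+ : (l : Dual n) (u w : Vector ℤ n) → l ⟨ (λ j → u j + w j) ⟩ ≡ l ⟨ u ⟩ + l ⟨ w ⟩
  ⟨⟩-+ l = GroupHomomorphism.homo l

  ⟨⟩-* : (l : Dual n) (m : ℕ) (u : Vector ℤ n) → l ⟨ (λ j → + m * u j) ⟩ ≡ + m * l ⟨ u ⟩
  ⟨⟩-* l ℕ.zero    u = GroupHomomorphism.ε-homo l
  ⟨⟩-* l (ℕ.suc m) u = begin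
    l ⟨ (λ j → + ℕ.suc m * u j) ⟩       ≡⟨ ⟨⟩-cong l (λ j → suc-* (+ m) (u j)) ⟩
    l ⟨ (λ j → u j + + m * u j) ⟩       ≡⟨ ⟨⟩-+ l u _ ⟩
    l ⟨ u ⟩ + l ⟨ (λ j → + m * u j) ⟩   ≡⟨ cong (l ⟨ u ⟩ +_) (⟨⟩-* l m u) ⟩
    l ⟨ u ⟩ + + m * l ⟨ u ⟩             ≡⟨ suc-* (+ m) (l ⟨ u ⟩) ⟨
    + ℕ.suc m * l ⟨ u ⟩                 ∎
    where open ≡-Reasoning

  ⟨⟩-sum : (l : Dual n) {q : ℕ} (ω : Fin q → ℕ) (v : Fin q → Vector ℤ n) →
           l ⟨ (λ j → sumℤ (λ i → + ω i * v i j)) ⟩ ≡ sumℤ (λ i → + ω i * l ⟨ v i ⟩)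
  ⟨⟩-sum l {ℕ.zero}  ω v = GroupHomomorphism.ε-homo l
  ⟨⟩-sum l {ℕ.suc q} ω v =
    trans (⟨⟩-+ l _ _) (cong₂ _+_ (⟨⟩-* l (ω zero) (v zero)) (⟨⟩-sum l (ω ∘ suc) (v ∘ suc)))

  infixl 6 _-ᴰ_

  _-ᴰ_ : Dual n → Dual n → Dual n
  h -ᴰ l = record
    { ⟦_⟧ = λ u → h ⟨ u ⟩ - l ⟨ u ⟩
    ; isGroupHomomorphism = record
      { isMonoidHomomorphism = record
        { isMagmaHomomorphism = record
          { isRelHomomorphism = record
            { cong = λ u≈w → cong₂ _-_ (⟨⟩-cong h u≈w) (⟨⟩-cong l u≈w) }
          ; homo = λ u w → trans (cong₂ _-_ (⟨⟩-+ h u w) (⟨⟩-+ l u w))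
                                 (-‿interchange (h ⟨ u ⟩) (h ⟨ w ⟩) (l ⟨ u ⟩) (l ⟨ w ⟩))
          }
        ; ε-homo = cong₂ _-_ (GroupHomomorphism.ε-homo h) (GroupHomomorphism.ε-homo l)
        }
      ; ⁻¹-homo = λ u → trans
          (cong₂ _-_ (GroupHomomorphism.⁻¹-homo h u) (GroupHomomorphism.⁻¹-homo l u))
          (sym (neg-distrib-+ (h ⟨ u ⟩) (- (l ⟨ u ⟩))))
      }
    }
    where
    -‿interchange : ∀ a b c d → (a + b) - (c + d) ≡ (a - c) + (b - d)
    -‿interchange = solve-∀

  ray-⊆ : {u w : Vector ℤ n} → u ≈ w → ray u ⊆ ray w
  ray-⊆ u≈w {x} (t , t≥0 , x≃) = t , t≥0 , λ j → subst (λ z → x j ≃ t · z) (u≈w j) (x≃ j)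

  ray-cong : {u w : Vector ℤ n} → u ≈ w → ray u ≐ ray w
  ray-cong u≈w = (λ {x} → ray-⊆ u≈w {x}) , (λ {x} → ray-⊆ (sym ∘ u≈w) {x})

module _ {n : ℕ} (F : TropicalFan₁ n) where
  open TropicalFan₁ F

  balanced-form : (l : Dual n) → sumℤ (λ i → + ω i * l ⟨ v i ⟩) ≡ 0ℤ
  balanced-form l = begin
    sumℤ (λ i → + ω i * l ⟨ v i ⟩)              ≡⟨ ⟨⟩-sum l ω v ⟨
    l ⟨ (λ j → sumℤ (λ i → + ω i * v i j)) ⟩    ≡⟨ ⟨⟩-cong l balanced ⟩
    l ⟨ (λ j → 0ℤ) ⟩                            ≡⟨ GroupHomomorphism.ε-homo l ⟩
    0ℤ                                          ∎
    where open ≡-Reasoning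

  degree-neg : (l : Dual n) → sumℤ (λ i → + ω i * (0ℤ ⊔ - (l ⟨ v i ⟩))) ≡ max[0,_]·F F l
  degree-neg l = sym (begin
    sumℤ (λ i → + ω i * (0ℤ ⊔ l ⟨ v i ⟩))
      ≡⟨ sum-cong-≗ (λ i → trans (cong (+ ω i *_) (positivePart-neg (l ⟨ v i ⟩)))
                                 (*-distribˡ-+ (+ ω i) (l ⟨ v i ⟩) _)) ⟩
    sumℤ (λ i → + ω i * l ⟨ v i ⟩ + + ω i * (0ℤ ⊔ - (l ⟨ v i ⟩)))
      ≡⟨ ∑-distrib-+ (λ i → + ω i * l ⟨ v i ⟩) _ ⟩
    sumℤ (λ i → + ω i * l ⟨ v i ⟩) + sumℤ (λ i → + ω i * (0ℤ ⊔ - (l ⟨ v i ⟩)))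
      ≡⟨ cong (_+ sumℤ (λ i → + ω i * (0ℤ ⊔ - (l ⟨ v i ⟩)))) (balanced-form l) ⟩
    0ℤ + sumℤ (λ i → + ω i * (0ℤ ⊔ - (l ⟨ v i ⟩)))
      ≡⟨ +-identityˡ _ ⟩
    sumℤ (λ i → + ω i * (0ℤ ⊔ - (l ⟨ v i ⟩))) ∎)
    where open ≡-Reasoning

  vanishes-off-gallery :
    (l : Dual n) → max[0,_]·F F l ≡ 1ℤ →
    ∀ {a b i} → l ⟨ v a ⟩ ≡ 1ℤ → l ⟨ v b ⟩ ≡ -1ℤ → a ≢ i → b ≢ i → l ⟨ v i ⟩ ≡ 0ℤ
  vanishes-off-gallery l deg la≡1 lb≡-1 a≢i b≢i = ≤-antisym
    (support-positivePart ω ω-positive (λ i → l ⟨ v i ⟩) deg la≡1 a≢i)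
    (neg-cancel-≤ (support-positivePart ω ω-positive (λ i → - (l ⟨ v i ⟩))
      (trans (degree-neg l) deg) (cong -_ lb≡-1) b≢i))

  isGallery⁺ :
    (f : Dual n) → max[0,_]·F F f ≡ 1ℤ →
    ∀ {a b} → f ⟨ v a ⟩ ≡ 1ℤ → f ⟨ v b ⟩ ≡ -1ℤ →
    (∀ {i} → a ≢ i → b ≢ i → f ⟨ v i ⟩ ≡ 0ℤ) →
    ∀ {u w} → u ≈ v a → w ≈ v b → IsGalleryOver F f (λ R → R ≐ ray u ⊎ R ≐ ray w)
  isGallery⁺ f deg {a} {b} fa≡1 fb≡-1 off {u} {w} u≈va w≈vb = record
    { degree  = deg
    ; gallery =
        [ (λ R≐u → a , ≐-trans R≐u (ray-cong u≈va) , cong ℤ.∣_∣ fa≡1)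
        , (λ R≐w → b , ≐-trans R≐w (ray-cong w≈vb) , cong ℤ.∣_∣ fb≡-1)
        ]′
      , from
    }
    where
    from : ∀ {R} → (∃ λ i → R ≐ ray (v i) × ℤ.∣ f ⟨ v i ⟩ ∣ ≡ 1) → R ≐ ray u ⊎ R ≐ ray w
    from (i , R≐vi , ∣fi∣≡1) with a ≟ i | b ≟ i
    ... | yes refl | _        = inj₁ (≐-trans R≐vi (ray-cong (sym ∘ u≈va)))
    ... | no _     | yes refl = inj₂ (≐-trans R≐vi (ray-cong (sym ∘ w≈vb)))
    ... | no a≢i   | no b≢i   =
      ⊥-elim (ℕ.0≢1+n (trans (cong ℤ.∣_∣ (sym (off a≢i b≢i))) ∣fi∣≡1))

lemma3p5 : ∀ {n : ℕ} (F : TropicalFan₁ n) → RaysSpan F →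
    (u₁ u₂ u₃ : Vector ℤ n) →
    u₁ ∈ PrimitiveGenerator F → u₂ ∈ PrimitiveGenerator F → u₃ ∈ PrimitiveGenerator F →
    (l h : Dual n) →
    g∈Gly F l u₁ u₂ → g∈Gly F h u₁ u₃ → ¬ (u₂ ≈ u₃) →
    ∃ λ (f : Dual n) → g∈Gly F f u₂ u₃
lemma3p5 {n} F _ u₁ u₂ u₃ (a , u₁≈) (b , u₂≈) (c , u₃≈) l h gₗ gₕ u₂≉u₃ =
  f , record
    { isGallery = isGallery⁺ F f degree-f fb≡1 fc≡-1 f-off u₂≈ u₃≈
    ; l⟨a⟩≡1    = trans (⟨⟩-cong f u₂≈) fb≡1
    ; l⟨b⟩≡-1   = trans (⟨⟩-cong f u₃≈) fc≡-1
    }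
  where
  open TropicalFan₁ F
  module L = g∈Gly gₗ
  module H = g∈Gly gₕ

  f : Dual n
  f = h -ᴰ l

  degree-l : max[0,_]·F F l ≡ 1ℤ
  degree-l = IsGalleryOver.degree L.isGallery

  la≡1 : l ⟨ v a ⟩ ≡ 1ℤ
  la≡1 = trans (sym (⟨⟩-cong l u₁≈)) L.l⟨a⟩≡1

  lb≡-1 : l ⟨ v b ⟩ ≡ -1ℤ
  lb≡-1 = trans (sym (⟨⟩-cong l u₂≈)) L.l⟨b⟩≡-1

  ha≡1 : h ⟨ v a ⟩ ≡ 1ℤ
  ha≡1 = trans (sym (⟨⟩-cong h u₁≈)) H.l⟨a⟩≡1

  hc≡-1 : h ⟨ v c ⟩ ≡ -1ℤ
  hc≡-1 = trans (sym (⟨⟩-cong h u₃≈)) H.l⟨b⟩≡-1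

  separates : (k : Dual n) → ∀ {i j} → k ⟨ v i ⟩ ≡ 1ℤ → k ⟨ v j ⟩ ≡ -1ℤ → i ≢ j
  separates k ki≡1 kj≡-1 refl with () ← trans (sym ki≡1) kj≡-1

  b≢c : b ≢ c
  b≢c refl = u₂≉u₃ (λ j → trans (u₂≈ j) (sym (u₃≈ j)))

  l-off : ∀ {i} → a ≢ i → b ≢ i → l ⟨ v i ⟩ ≡ 0ℤ
  l-off = vanishes-off-gallery F l degree-l la≡1 lb≡-1

  h-off : ∀ {i} → a ≢ i → c ≢ i → h ⟨ v i ⟩ ≡ 0ℤ
  h-off = vanishes-off-gallery F h (IsGalleryOver.degree H.isGallery) ha≡1 hc≡-1

  fa≡0 : f ⟨ v a ⟩ ≡ 0ℤ
  fa≡0 = cong₂ _-_ ha≡1 la≡1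

  fb≡1 : f ⟨ v b ⟩ ≡ 1ℤ
  fb≡1 = cong₂ _-_ (h-off (separates l la≡1 lb≡-1) (b≢c ∘ sym)) lb≡-1

  lc≡0 : l ⟨ v c ⟩ ≡ 0ℤ
  lc≡0 = l-off (separates h ha≡1 hc≡-1) b≢c

  fc≡-1 : f ⟨ v c ⟩ ≡ -1ℤ
  fc≡-1 = cong₂ _-_ hc≡-1 lc≡0

  f-off : ∀ {i} → b ≢ i → c ≢ i → f ⟨ v i ⟩ ≡ 0ℤ
  f-off {i} b≢i c≢i with a ≟ i
  ... | yes refl = fa≡0
  ... | no a≢i   = cong₂ _-_ (h-off a≢i c≢i) (l-off a≢i b≢i)

  positivePart-f : ∀ i → 0ℤ ⊔ f ⟨ v i ⟩ ≡ 0ℤ ⊔ - (l ⟨ v i ⟩)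
  positivePart-f i with a ≟ i | c ≟ i
  ... | yes refl | _        = trans (cong (0ℤ ⊔_) fa≡0) (cong (λ z → 0ℤ ⊔ - z) (sym la≡1))
  ... | no _     | yes refl = trans (cong (0ℤ ⊔_) fc≡-1) (cong (λ z → 0ℤ ⊔ - z) (sym lc≡0))
  ... | no a≢i   | no c≢i   = cong (0ℤ ⊔_)
    (trans (cong (_- l ⟨ v i ⟩) (h-off a≢i c≢i)) (+-identityˡ (- (l ⟨ v i ⟩))))

  degree-f : max[0,_]·F F f ≡ 1ℤ
  degree-f = trans (sum-cong-≗ (λ i → cong (+ ω i *_) (positivePart-f i)))
                   (trans (degree-neg F l) degree-l)
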